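{- The prime $v$-palindromes (in base $10$) are precisely the primes of the form $$5\cdot 10^m-1 \;=\; 4\underbrace{9\cdots 9}_{m}$$ for some integer $m\geq 4$, such that $$5\cdot 10^m-3 \;=\; 4\underbrace{9\cdots 9}_{m-1}7$$ is also prime. That is, a prime $p$ is a $v$-palindrome if and only if there is an integer $m\ge 4$ with $p=5\cdot 10^m-1$ and $5\cdot 10^m-3$ prime.
   Context: For an integer $n\geq 1$ with decimal representation $n=\sum_{i=0}^{L-1}a_i10^i$, where $0\le a_i\le 9$ and $a_{L-1}\neq 0$, the reverse of $n$ is $r(n):=\sum_{i=0}^{L-1}a_{L-1-i}10^{i}$ (the integer formed by reversing the decimal digits of $n$). The additive function $v\colon\mathbb{N}\to\mathbb{Z}$ (additive means $v(ab)=v(a)+v(b)$ for coprime $a,b$; in particular $v(1)=0$) is defined by $v(p):=p$ for primes $p$ and $v(p^\alpha):=p+\alpha$ for prime powers $p^\alpha$ with $\alpha\geq 2$. An integer $n\geq 1$ is a $v$-palindrome (in base $10$) if $10\nmid n$, $n\neq r(n)$, and $v(n)=v(r(n))$. A prime $v$-palindrome is a $v$-palindrome that is a prime number. -}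

module Defs where

open import Data.Digit using (Digit; Expansion; fromDigits)
open import Data.Fin.Base using (toℕ)
open import Data.Fin.Properties using (toℕ<n; toℕ-injective; toℕ-fromℕ<)
import Data.Integer.Base as ℤ
open import Data.Integer.Base using (ℤ; +_; 0ℤ)
open import Data.List.Base
  using (List; []; _∷_; _++_; _∷ʳ_; map; filter; length; replicate; reverse; deduplicate)
open import Data.List.Membership.Propositional using (_∈_; _∉_)
open import Data.List.Membership.Propositional.Properties
  using (deduplicate-∈⇔; ∈-deduplicate⁻)
open import Data.List.Membership.Propositional.Properties.WithK using (unique∧set⇒bag)
open import Data.List.Properties
  using ( map-cong; map-cong-local; map-++; length-++; filter-++; filter-all; filter-none
        ; length-replicate)
open import Data.List.Relation.Binary.BagAndSetEquality using (∼bag⇒↭)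
open import Data.List.Relation.Binary.Disjoint.Propositional using (Disjoint)
open import Data.List.Relation.Binary.Permutation.Propositional using (_↭_; ↭-sym)
open import Data.List.Relation.Binary.Permutation.Propositional.Properties
  using (filter-↭; ↭-length; map⁺; ∈-resp-↭)
open import Data.List.Relation.Binary.Permutation.Propositional.Properties.WithK
  using (dedup-++-↭)
import Data.List.Relation.Unary.All as All
open import Data.List.Relation.Unary.All.Properties using (replicate⁺; deduplicate⁺; ++⁺)
open import Data.Nat.Base
  using (ℕ; zero; suc; 2+; _+_; _*_; _^_; _≤_; _<_; s≤s; sz<ss; NonZero)
open import Data.Nat.Coprimality using (Coprime)
open import Data.Nat.DivMod
  using ( _/_; _mod_; m/n<m; m%n<n; m≡m%n+[m/n]*n; [m+kn]%n≡m%n; m<n⇒m%n≡m; m<n⇒m/n≡0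
        ; m*n/n≡m; +-distrib-/-∣ʳ)
open import Data.Nat.Divisibility using (_∣_; _∤_; n∣m*n)
open import Data.Nat.Induction using (Acc; acc; <-wellFounded-fast)
open import Data.Nat.ListAction using (sum; product)
open import Data.Nat.ListAction.Properties using (sum-++; sum-↭; product-++; ∈⇒∣product)
open import Data.Nat.Primality using (Prime; prime⇒nonZero; ¬prime[1])
open import Data.Nat.Primality.Factorisation
  using (PrimeFactorisation; factors; factorise; factorisationUnique)
open import Data.Nat.Properties
  using (_≟_; m*n≢0; m^n≢0; +-identityʳ; *-identityʳ; m*n≡0⇒m≡0; m+n≡0⇒n≡0)
open import Data.Product.Base using (∃-syntax; _,_)
open import Function.Base using (_∘_; _$_)
open import Function.Bundles using (mk⇔)
open import Function.Related.Propositional using (module EquationalReasoning; SK-sym)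
open import Relation.Binary.PropositionalEquality
  using (_≡_; _≢_; refl; sym; trans; cong; cong₂; subst; module ≡-Reasoning)
open import Relation.Nullary.Decidable using (¬?)
open import Relation.Nullary.Negation using (contradiction)
open import Data.List.Relation.Unary.Unique.DecPropositional.Properties _≟_
  using (deduplicate-!)

digitsAcc : ∀ n → Acc _<_ n → Expansion 10
digitsAcc zero      _        = []
digitsAcc n@(suc _) (acc rs) = n mod 10 ∷ digitsAcc (n / 10) (rs (m/n<m n 10 sz<ss))

-- Least significant digit first, as fromDigits expects, with no leading zero
-- (at the end of the list).  The library's toDigits is not used because its
-- type says nothing about leading zeros, on which the reverse depends.
digits : ℕ → Expansion 10
digits n = digitsAcc n (<-wellFounded-fast n)

r : ℕ → ℕ
r n = fromDigits (reverse (digits n))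

-- The contribution v(p^α) of the prime p to an integer exactly divisible by p^α.
vPrimePower : (p α : ℕ) → ℕ
vPrimePower p 0        = 0
vPrimePower p 1        = p
vPrimePower p α@(2+ _) = p + α

multiplicity : ℕ → List ℕ → ℕ
multiplicity p ps = length (filter (p ≟_) ps)

-- ps is a list of primes with repetition, standing for the integer product ps.
vFactors : List ℕ → ℕ
vFactors ps = sum (map (λ p → vPrimePower p (multiplicity p ps)) (deduplicate _≟_ ps))

-- The value at 0 is a dummy: v is meant for positive integers only.  That v
-- is the additive function with v(p) = p and v(p^α) = p + α for α ≥ 2 is the
-- content of v-prime, v-primePower and v-additive.
v : ℕ → ℤ
v zero      = 0ℤ
v n@(suc _) = + vFactors (factors (factorise n))

record VPalindrome (n : ℕ) : Set where
  field
    positive : 1 ≤ n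
    10∤n     : 10 ∤ n
    n≢rn     : n ≢ r n
    vn≡vrn   : v n ≡ v (r n)

private
  digitsAcc-step : ∀ (d : Digit 10) m (a : Acc _<_ (toℕ d + m * 10)) → toℕ d + m * 10 ≢ 0 →
                   ∃[ a′ ] digitsAcc (toℕ d + m * 10) a ≡ d ∷ digitsAcc m a′
  digitsAcc-step d m a n≢0 = go (toℕ d + m * 10) a n≢0 mod≡ div≡
    where
    mod≡ : (toℕ d + m * 10) mod 10 ≡ d
    mod≡ = toℕ-injective (trans (toℕ-fromℕ< (m%n<n (toℕ d + m * 10) 10))
             (trans ([m+kn]%n≡m%n (toℕ d) m 10) (m<n⇒m%n≡m (toℕ<n d))))

    div≡ : (toℕ d + m * 10) / 10 ≡ m
    div≡ = trans (+-distrib-/-∣ʳ (toℕ d) (n∣m*n m))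
                 (cong₂ _+_ (m<n⇒m/n≡0 (toℕ<n d)) (m*n/n≡m m 10))

    go : ∀ n (a : Acc _<_ n) → n ≢ 0 → n mod 10 ≡ d → n / 10 ≡ m →
         ∃[ a′ ] digitsAcc n a ≡ d ∷ digitsAcc m a′
    go zero      _        n≢0 _    _    = contradiction refl n≢0
    go n@(suc _) (acc rs) _   refl refl = rs (m/n<m n 10 sz<ss) , refl

  fromDigits≢0 : ∀ ds (d : Digit 10) → toℕ d ≢ 0 → fromDigits (ds ∷ʳ d) ≢ 0
  fromDigits≢0 []       d d≢0 eq = d≢0 (trans (sym (+-identityʳ (toℕ d))) eq)
  fromDigits≢0 (c ∷ ds) d d≢0 eq =
    fromDigits≢0 ds d d≢0 (m*n≡0⇒m≡0 _ 10 (m+n≡0⇒n≡0 (toℕ c) eq))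

  digitsAcc-fromDigits : ∀ ds (d : Digit 10) → toℕ d ≢ 0 → (a : Acc _<_ (fromDigits (ds ∷ʳ d))) →
                         digitsAcc (fromDigits (ds ∷ʳ d)) a ≡ ds ∷ʳ d
  digitsAcc-fromDigits []       d d≢0 a =
    let _ , eq = digitsAcc-step d 0 a (fromDigits≢0 [] d d≢0) in eq
  digitsAcc-fromDigits (c ∷ ds) d d≢0 a =
    let a′ , eq = digitsAcc-step c (fromDigits (ds ∷ʳ d)) a (fromDigits≢0 (c ∷ ds) d d≢0)
    in trans eq (cong (c ∷_) (digitsAcc-fromDigits ds d d≢0 a′))

-- ds ∷ʳ d is the decimal representation, d being its nonzero leading digit.
r-fromDigits : ∀ ds (d : Digit 10) → toℕ d ≢ 0 →
               r (fromDigits (ds ∷ʳ d)) ≡ fromDigits (reverse (ds ∷ʳ d))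
r-fromDigits ds d d≢0 = cong (fromDigits ∘ reverse) (digitsAcc-fromDigits ds d d≢0 _)

fromDigits-digits : ∀ n → fromDigits (digits n) ≡ n
fromDigits-digits n = go n (<-wellFounded-fast n)
  where
  go : ∀ n a → fromDigits (digitsAcc n a) ≡ n
  go zero      _        = refl
  go n@(suc _) (acc rs) = trans
    (cong₂ (λ x y → x + y * 10) (toℕ-fromℕ< (m%n<n n 10)) (go (n / 10) (rs (m/n<m n 10 sz<ss))))
    (sym (m≡m%n+[m/n]*n n 10))

private
  multiplicity-↭ : ∀ p {as bs} → as ↭ bs → multiplicity p as ≡ multiplicity p bs
  multiplicity-↭ p as↭bs = ↭-length (filter-↭ (p ≟_) as↭bs)

  deduplicate-↭ : ∀ {as bs} → as ↭ bs → deduplicate _≟_ as ↭ deduplicate _≟_ bs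
  deduplicate-↭ {as} {bs} as↭bs =
    ∼bag⇒↭ $ unique∧set⇒bag (deduplicate-! as) (deduplicate-! bs) λ {x} → begin
    x ∈ deduplicate _≟_ as  ∼⟨ SK-sym (deduplicate-∈⇔ _≟_) ⟩
    x ∈ as                  ∼⟨ mk⇔ (∈-resp-↭ as↭bs) (∈-resp-↭ (↭-sym as↭bs)) ⟩
    x ∈ bs                  ∼⟨ deduplicate-∈⇔ _≟_ ⟩
    x ∈ deduplicate _≟_ bs  ∎
    where open EquationalReasoning

  vFactors-↭ : ∀ {as bs} → as ↭ bs → vFactors as ≡ vFactors bs
  vFactors-↭ {as} as↭bs = trans
    (cong sum (map-cong (λ p → cong (vPrimePower p) (multiplicity-↭ p as↭bs)) (deduplicate _≟_ as)))
    (sum-↭ (map⁺ _ (deduplicate-↭ as↭bs)))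

  multiplicity-++ : ∀ p as bs → multiplicity p (as ++ bs) ≡ multiplicity p as + multiplicity p bs
  multiplicity-++ p as bs = trans (cong length (filter-++ (p ≟_) as bs)) (length-++ (filter (p ≟_) as))

  multiplicity-∉ : ∀ {p as} → p ∉ as → multiplicity p as ≡ 0
  multiplicity-∉ {p} p∉as = cong length (filter-none (p ≟_) (All.tabulate λ { x∈as refl → p∉as x∈as }))

  vFactors-++ : ∀ as bs → Disjoint as bs → vFactors (as ++ bs) ≡ vFactors as + vFactors bs
  vFactors-++ as bs as#bs = begin
    sum (map f (dedup (as ++ bs)))                     ≡⟨ sum-↭ (map⁺ f (dedup-++-↭ _≟_ as#bs)) ⟩
    sum (map f (dedup as ++ dedup bs))                 ≡⟨ cong sum (map-++ f (dedup as) (dedup bs)) ⟩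
    sum (map f (dedup as) ++ map f (dedup bs))         ≡⟨ sum-++ (map f (dedup as)) (map f (dedup bs)) ⟩
    sum (map f (dedup as)) + sum (map f (dedup bs))    ≡⟨ cong₂ (λ x y → sum x + sum y)
                                                           (map-cong-local (All.tabulate onAs))
                                                           (map-cong-local (All.tabulate onBs)) ⟩
    vFactors as + vFactors bs                          ∎
    where
    open ≡-Reasoning
    dedup = deduplicate _≟_
    f = λ p → vPrimePower p (multiplicity p (as ++ bs))

    onAs : ∀ {p} → p ∈ dedup as → f p ≡ vPrimePower p (multiplicity p as)
    onAs {p} p∈as = cong (vPrimePower p) $ begin
      multiplicity p (as ++ bs)           ≡⟨ multiplicity-++ p as bs ⟩
      multiplicity p as + multiplicity p bs
        ≡⟨ cong (λ x → multiplicity p as + x) (multiplicity-∉ λ p∈bs → as#bs (∈-deduplicate⁻ _≟_ as p∈as , p∈bs)) ⟩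
      multiplicity p as + 0               ≡⟨ +-identityʳ _ ⟩
      multiplicity p as                   ∎

    onBs : ∀ {p} → p ∈ dedup bs → f p ≡ vPrimePower p (multiplicity p bs)
    onBs {p} p∈bs = cong (vPrimePower p) $ begin
      multiplicity p (as ++ bs)           ≡⟨ multiplicity-++ p as bs ⟩
      multiplicity p as + multiplicity p bs
        ≡⟨ cong (_+ multiplicity p bs) (multiplicity-∉ λ p∈as → as#bs (p∈as , ∈-deduplicate⁻ _≟_ bs p∈bs)) ⟩
      multiplicity p bs                   ∎

  vFactors-replicate : ∀ p k → vFactors (replicate (suc k) p) ≡ vPrimePower p (suc k)
  vFactors-replicate p k = begin
    sum (map f (deduplicate _≟_ ps))  ≡⟨ cong (sum ∘ map f ∘ (p ∷_))
                                           (filter-none (¬? ∘ (p ≟_)) (deduplicate⁺ _≟_ others)) ⟩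
    f p + 0                           ≡⟨ +-identityʳ (f p) ⟩
    f p                               ≡⟨ cong (vPrimePower p ∘ length)
                                           (filter-all (p ≟_) (replicate⁺ (suc k) refl)) ⟩
    vPrimePower p (length ps)         ≡⟨ cong (vPrimePower p) (length-replicate (suc k)) ⟩
    vPrimePower p (suc k)             ∎
    where
    open ≡-Reasoning
    ps = replicate (suc k) p
    f = λ q → vPrimePower q (multiplicity q ps)
    others = replicate⁺ k λ p≢p → p≢p refl

v-factors : ∀ n .{{_ : NonZero n}} (f : PrimeFactorisation n) → v n ≡ + vFactors (factors f)
v-factors n@(suc _) f = cong +_ (vFactors-↭ (factorisationUnique (factorise n) f))

private
  v-primePower′ : ∀ {p} → Prime p → ∀ k → v (p ^ suc k) ≡ + vPrimePower p (suc k)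
  v-primePower′ {p} pr k =
    trans (v-factors (p ^ suc k) {{m^n≢0 p (suc k)}} fac) (cong +_ (vFactors-replicate p k))
    where
    instance _ = prime⇒nonZero pr
    product-replicate : ∀ α → p ^ α ≡ product (replicate α p)
    product-replicate zero    = refl
    product-replicate (suc α) = cong (p *_) (product-replicate α)
    fac : PrimeFactorisation (p ^ suc k)
    fac = record
      { factors         = replicate (suc k) p
      ; isFactorisation = product-replicate (suc k)
      ; factorsPrime    = replicate⁺ (suc k) pr
      }

v-prime : ∀ {p} → Prime p → v p ≡ + p
v-prime {p} pr = trans (cong v (sym (*-identityʳ p))) (v-primePower′ pr 0)

v-primePower : ∀ {p α} → Prime p → 2 ≤ α → v (p ^ α) ≡ + (p + α)
v-primePower {α = 2+ k} pr _ = v-primePower′ pr (suc k)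
v-primePower {α = 1} pr (s≤s ())

v-additive : ∀ a b .{{_ : NonZero a}} .{{_ : NonZero b}} → Coprime a b → v (a * b) ≡ v a ℤ.+ v b
v-additive a b coprime = begin
  v (a * b)
    ≡⟨ v-factors (a * b) {{m*n≢0 a b}} fab ⟩
  + vFactors (factors fa ++ factors fb)
    ≡⟨ cong +_ (vFactors-++ (factors fa) (factors fb) disjoint) ⟩
  + vFactors (factors fa) ℤ.+ + vFactors (factors fb)
    ≡⟨ cong₂ ℤ._+_ (v-factors a fa) (v-factors b fb) ⟨
  v a ℤ.+ v b
    ∎
  where
  open ≡-Reasoning
  open PrimeFactorisation using (isFactorisation; factorsPrime)
  fa = factorise a
  fb = factorise b

  fab : PrimeFactorisation (a * b)
  fab = record
    { factors         = factors fa ++ factors fb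
    ; isFactorisation = trans (cong₂ _*_ (isFactorisation fa) (isFactorisation fb))
                              (sym (product-++ (factors fa) (factors fb)))
    ; factorsPrime    = ++⁺ (factorsPrime fa) (factorsPrime fb)
    }

  disjoint : Disjoint (factors fa) (factors fb)
  disjoint {p} (p∈a , p∈b) = ¬prime[1] (subst Prime (coprime (p∣a , p∣b)) (All.lookup (factorsPrime fa) p∈a))
    where
    p∣a : p ∣ a
    p∣a = subst (p ∣_) (sym (isFactorisation fa)) (∈⇒∣product p∈a)
    p∣b : p ∣ b
    p∣b = subst (p ∣_) (sym (isFactorisation fb)) (∈⇒∣product p∈b)

{-# OPTIONS --safe #-}
module Submission where

-- Let p be a v-palindrome prime and q = r(p), so that v(q) = p, which exceeds
-- q/10.  Since v(ab) = v(a) + v(b) for coprime a and b, v(q) is that large only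
-- if q is small or q = kP with P prime and k ≤ 10; then p = v(k) + P.  As p and P
-- are odd, v(k) is even, so k is 2 or 4 (k = 1 gives p = q), and q = k(p − v(k)).
-- The first and the last digits exclude k = 4 and, for k = 2, are 4 and 9.  The
-- inner digits, complemented to 9, then form a string whose value is doubled by
-- reversal; peeling off outer digits shows that this string is zero.

open import Defs
import Data.Fin.Properties as Fin
import Data.Integer.Base as ℤ
import Data.Integer.Properties as ℤ
import Data.List.Relation.Unary.All as All
import Data.Nat.Coprimality as Coprime
open import Data.Digit using (Digit; Expansion; fromDigits)
open import Data.Fin using (#_)
open import Data.Fin.Base using (toℕ; opposite)
open import Data.Fin.Properties using (toℕ<n; opposite-prop)
open import Data.Integer.Base using (+_; ∣_∣)
open import Data.List.Base
  using (List; []; _∷_; _∷ʳ_; length; reverse; map; replicate; initLast; _∷ʳ′_)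
open import Data.List.Properties
  using ( unfold-reverse; reverse-++; reverse-map
        ; length-++; length-reverse; length-replicate)
open import Data.List.Relation.Unary.All using (All)
open import Data.Nat.Base
open import Data.Nat.Coprimality using (Coprime; 1-coprimeTo; coprime-divisor)
open import Data.Nat.DivMod using (_%_; _/_; m%n<n; [m+kn]%n≡m%n; %-distribˡ-+)
open import Data.Nat.Divisibility
open import Data.Nat.Induction using (<-rec)
open import Data.Nat.ListAction using (product)
open import Data.Nat.Primality
open import Data.Nat.Primality.Factorisation using (factorise)
open import Data.Nat.Properties
open import Data.Nat.Tactic.RingSolver using (solve)
open import Data.Product.Base using (∃-syntax; _×_; _,_; proj₁; proj₂)
open import Data.Sum.Base using (_⊎_; inj₁; inj₂)
open import Function.Base using (it)
open import Function.Bundles using (_⇔_; mk⇔)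
open import Relation.Binary.PropositionalEquality
  using (_≡_; _≢_; refl; sym; trans; cong; cong₂; subst; module ≡-Reasoning)
open import Relation.Nullary.Decidable
  using (yes; no; Dec; _×-dec_; _⊎-dec_; _→-dec_; ¬?; toWitness)
open import Relation.Nullary.Negation using (contradiction; ¬_)

-- Coprimality and splitting off a prime power

m+o≡n⇒m≤n : ∀ {m n} o → m + o ≡ n → m ≤ n
m+o≡n⇒m≤n o refl = m≤m+n _ o

coprime-* : ∀ {a b m} → Coprime a m → Coprime b m → Coprime (a * b) m
coprime-* a⊥m b⊥m (d∣ab , d∣m) =
  b⊥m (coprime-divisor (λ (e∣d , e∣a) → a⊥m (e∣a , ∣-trans e∣d d∣m)) d∣ab , d∣m)

coprime-^ : ∀ {a m} e → Coprime a m → Coprime (a ^ e) m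
coprime-^ zero    _   = 1-coprimeTo _
coprime-^ (suc e) a⊥m = coprime-* a⊥m (coprime-^ e a⊥m)

prime∤⇒coprime : ∀ {p m} → Prime p → p ∤ m → Coprime p m
prime∤⇒coprime pr p∤m (d∣p , d∣m) with prime⇒irreducible pr d∣p
... | inj₁ d≡1  = d≡1
... | inj₂ refl = contradiction d∣m p∤m

coprime-∣ʳ : ∀ {a b k} → Coprime a b → k ∣ b → Coprime a k
coprime-∣ʳ a⊥b k∣b (d∣a , d∣k) = a⊥b (d∣a , ∣-trans d∣k k∣b)

primeDivisor : ∀ n → 2 ≤ n → ∃[ p ] Prime p × p ∣ n
primeDivisor n@(2+ _) (s≤s _) with factorise n
... | record { factors = [] ; isFactorisation = () }
... | record { factors = p ∷ ps ; isFactorisation = eq ; factorsPrime = prs } =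
  p , All.head prs , subst (p ∣_) (sym eq) (m∣m*n _)

removePrime : ∀ {p} → Prime p → ∀ n .{{_ : NonZero n}} → ∃[ e ] ∃[ m ] p ∤ m × n ≡ p ^ e * m
removePrime {p} pr = λ n → <-rec P step n
  where
  P = λ n → .{{_ : NonZero n}} → ∃[ e ] ∃[ m ] p ∤ m × n ≡ p ^ e * m
  step : ∀ n → (∀ {k} → k < n → P k) → P n
  step n rec with p ∣? n
  ... | no p∤n = 0 , n , p∤n , sym (+-identityʳ n)
  ... | yes (divides q refl)
    with e , m , p∤m , eq ← rec (m<m*n q p {{m*n≢0⇒m≢0 q}} (nonTrivial⇒n>1 p {{prime⇒nonTrivial pr}})) {{m*n≢0⇒m≢0 q}}
    = suc e , m , p∤m , trans (*-comm q p) (trans (cong (p *_) eq) (sym (*-assoc p (p ^ e) m)))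

primePowerSplit : ∀ n → 2 ≤ n → ∃[ p ] ∃[ e ] ∃[ m ] Prime p × p ∤ m × n ≡ p ^ suc e * m
primePowerSplit 1        (s≤s ())
primePowerSplit n@(2+ _) 2≤n
  with p , pr , p∣n ← primeDivisor n 2≤n
  with removePrime pr n
... | suc e , m , p∤m , eq = p , e , m , pr , p∤m , eq
... | zero , m , p∤m , eq = contradiction (subst (p ∣_) (trans eq (+-identityʳ m)) p∣n) p∤m

-- The values of `v` as natural numbers, and the bound `v(n) ≤ n`

ω : ℕ → ℕ
ω n = ∣ v n ∣

v≡+ω : ∀ n → v n ≡ + ω n
v≡+ω zero    = refl
v≡+ω (suc _) = refl

ω-prime : ∀ {p} → Prime p → ω p ≡ p
ω-prime pr = cong ∣_∣ (v-prime pr)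

ω-primePower : ∀ {p} → Prime p → ∀ e → ω (p ^ 2+ e) ≡ p + 2+ e
ω-primePower pr e = cong ∣_∣ (v-primePower pr (s≤s (s≤s z≤n)))

ω-* : ∀ a b .{{_ : NonZero a}} .{{_ : NonZero b}} → Coprime a b → ω (a * b) ≡ ω a + ω b
ω-* a b a⊥b = cong ∣_∣ (trans (v-additive a b a⊥b) (cong₂ ℤ._+_ (v≡+ω a) (v≡+ω b)))

m+n≤m*n : ∀ {m n} → 2 ≤ m → 2 ≤ n → m + n ≤ m * n
m+n≤m*n 2≤m 2≤n
  with x , refl ← m≤n⇒∃[o]m+o≡n 2≤m | y , refl ← m≤n⇒∃[o]m+o≡n 2≤n
  = m+o≡n⇒m≤n (x + y + x * y) (solve (x ∷ y ∷ []))

ω-primePower≤ : ∀ {p} → Prime p → ∀ e → ω (p ^ suc e) ≤ p ^ suc e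
ω-primePower≤ {p} pr zero = ≤-reflexive (trans (cong ω (*-identityʳ p)) (trans (ω-prime pr) (sym (*-identityʳ p))))
ω-primePower≤ {p} pr (suc e) = begin
  ω (p ^ 2+ e)     ≡⟨ ω-primePower pr e ⟩
  p + 2+ e         ≤⟨ go e ⟩
  p ^ 2+ e         ∎
  where
  open ≤-Reasoning
  instance _ = prime⇒nonZero pr
  2≤p = nonTrivial⇒n>1 p {{prime⇒nonTrivial pr}}
  go : ∀ e → p + 2+ e ≤ p ^ 2+ e
  go zero    = subst (λ x → p + 2 ≤ p * x) (sym (*-identityʳ p)) (≤-trans (+-monoʳ-≤ p 2≤p) (m+n≤m*n 2≤p 2≤p))
  go (suc e) = begin
    p + (3 + e)           ≡⟨ +-suc p (2+ e) ⟩
    suc (p + 2+ e)        ≤⟨ +-mono-≤ (m^n>0 p (2+ e)) (go e) ⟩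
    p ^ 2+ e + p ^ 2+ e   ≡⟨ cong (λ x → p ^ 2+ e + x) (+-identityʳ _) ⟨
    2 * p ^ 2+ e          ≤⟨ *-monoˡ-≤ (p ^ 2+ e) 2≤p ⟩
    p ^ (3 + e)           ∎

≢1⇒≥2 : ∀ m .{{_ : NonZero m}} → m ≢ 1 → 2 ≤ m
≢1⇒≥2 1      m≢1 = contradiction refl m≢1
≢1⇒≥2 (2+ _) _   = s≤s (s≤s z≤n)

2≤primePower : ∀ {p} → Prime p → ∀ e → 2 ≤ p ^ suc e
2≤primePower {p} pr e =
  ≤-trans (nonTrivial⇒n>1 p {{prime⇒nonTrivial pr}}) (m≤m*n p (p ^ e) {{m^n≢0 p e {{prime⇒nonZero pr}}}})

-- The induction principle suited to an additive function: any `n` above 1 splits off the full power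
-- of one of its primes, leaving a smaller cofactor coprime to it.
coprimeInduction : (P : ℕ → Set) → P 1 →
  (∀ {p} → Prime p → ∀ e m .{{_ : NonZero m}} → Coprime (p ^ suc e) m → P m → P (p ^ suc e * m)) →
  ∀ n .{{_ : NonZero n}} → P n
coprimeInduction P P1 P* = λ n → <-rec Q step n
  where
  Q = λ n → .{{_ : NonZero n}} → P n
  step : ∀ n → (∀ {k} → k < n → Q k) → Q n
  step 1 _ = P1
  step n@(2+ _) rec with p , e , m , pr , p∤m , eq ← primePowerSplit n (s≤s (s≤s z≤n)) =
    subst P (sym eq) (P* pr e m (coprime-^ (suc e) (prime∤⇒coprime pr p∤m)) (rec m<n))
    where
    instance
      m≢0 : NonZero m
      m≢0 = m*n≢0⇒n≢0 (p ^ suc e) {{subst NonZero eq _}}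
    m<n : m < n
    m<n = subst (m <_) (trans (*-comm m _) (sym eq)) (m<m*n m (p ^ suc e) (2≤primePower pr e))

ω-≤ : ∀ n .{{_ : NonZero n}} → ω n ≤ n
ω-≤ = coprimeInduction (λ n → ω n ≤ n) z≤n step
  where
  step : ∀ {p} → Prime p → ∀ e m .{{_ : NonZero m}} → Coprime (p ^ suc e) m → ω m ≤ m →
         ω (p ^ suc e * m) ≤ p ^ suc e * m
  step {p} pr e m q⊥m ωm≤m with m ≟ 1
  -- The cofactor 1 is treated apart because `m+n≤m*n` needs both factors to be at least 2.
  ... | yes refl = subst (λ x → ω x ≤ x) (sym (*-identityʳ _)) (ω-primePower≤ pr e)
  ... | no m≢1   = begin
    ω (p ^ suc e * m)      ≡⟨ ω-* _ m {{m^n≢0 p (suc e) {{prime⇒nonZero pr}}}} q⊥m ⟩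
    ω (p ^ suc e) + ω m    ≤⟨ +-mono-≤ (ω-primePower≤ pr e) ωm≤m ⟩
    p ^ suc e + m          ≤⟨ m+n≤m*n (2≤primePower pr e) (≢1⇒≥2 m m≢1) ⟩
    p ^ suc e * m          ∎
    where open ≤-Reasoning

-- Integers `n` with `v(n)` larger than about `n / 11`

c*[m+n]≤m*n+c*c : ∀ {c m n} → c ≤ m → c ≤ n → c * (m + n) ≤ m * n + c * c
c*[m+n]≤m*n+c*c {c} c≤m c≤n
  with x , refl ← m≤n⇒∃[o]m+o≡n c≤m | y , refl ← m≤n⇒∃[o]m+o≡n c≤n
  = m+o≡n⇒m≤n (x * y) (solve (c ∷ x ∷ y ∷ []))

-- The difference of the two sides is `(m - 1) * (n - c) - c`, where the first factor is at least 1
-- and the second at least `c`.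
c*m+n≤m*n : ∀ {c m n} → 2 ≤ m → 2 * c ≤ n → c * m + n ≤ m * n
c*m+n≤m*n {c} 2≤m 2c≤n
  with x , refl ← m≤n⇒∃[o]m+o≡n 2≤m | y , refl ← m≤n⇒∃[o]m+o≡n 2c≤n
  = m+o≡n⇒m≤n (y + c * x + x * y) (solve (c ∷ x ∷ y ∷ []))

11*[m+n]≤m*n+1000 : ∀ {m n} → 11 ≤ m → 11 ≤ n → 11 * (m + n) ≤ m * n + 1000
11*[m+n]≤m*n+1000 {m} {n} 11≤m 11≤n =
  ≤-trans (c*[m+n]≤m*n+c*c 11≤m 11≤n) (+-monoʳ-≤ (m * n) (m≤n+m 121 879))

-- From `e = 5` on, a step adds 22 on the left and at least 32 on the right; the cases up to 5 are
-- computed.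
22*e≤2^e+110 : ∀ e → 22 * e ≤ 2 ^ e + 110
22*e≤2^e+110 0 = z≤n
22*e≤2^e+110 1 = m+o≡n⇒m≤n 90 refl
22*e≤2^e+110 2 = m+o≡n⇒m≤n 70 refl
22*e≤2^e+110 3 = m+o≡n⇒m≤n 52 refl
22*e≤2^e+110 4 = m+o≡n⇒m≤n 38 refl
22*e≤2^e+110 (suc e@(suc (suc (suc (suc (suc d)))))) = begin
  22 * suc e              ≡⟨ *-suc 22 e ⟩
  22 + 22 * e             ≤⟨ +-mono-≤ 22≤2^e (22*e≤2^e+110 e) ⟩
  2 ^ e + (2 ^ e + 110)   ≡⟨ +-assoc (2 ^ e) (2 ^ e) 110 ⟨
  2 ^ e + 2 ^ e + 110     ≡⟨ cong (λ x → 2 ^ e + x + 110) (+-identityʳ (2 ^ e)) ⟨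
  2 * 2 ^ e + 110         ∎
  where
  open ≤-Reasoning
  22≤2^e : 22 ≤ 2 ^ e
  22≤2^e = ≤-trans (m+o≡n⇒m≤n 10 refl) (^-monoʳ-≤ 2 (m≤m+n 5 d))
22*e≤2^e+110 (suc 4) = m+o≡n⇒m≤n 32 refl

-- After doubling, `22 * p` and `22 * e` are bounded separately, each against its own copy of
-- `p ^ e`. The constant 484 is the square of 22, which covers `p ≤ 22`; beyond that
-- `22 * p ≤ p * p`.
11*[p+e]≤p^e+500 : ∀ p e → 2 ≤ p → 2 ≤ e → 11 * (p + e) ≤ p ^ e + 500
11*[p+e]≤p^e+500 p e 2≤p 2≤e = *-cancelˡ-≤ 2 (begin
  2 * (11 * (p + e))               ≡⟨ trans (sym (*-assoc 2 11 (p + e))) (*-distribˡ-+ 22 p e) ⟩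
  22 * p + 22 * e                  ≤⟨ +-mono-≤ 22p≤ (22*e≤2^e+110 e) ⟩
  p ^ e + 484 + (2 ^ e + 110)      ≤⟨ +-monoʳ-≤ (p ^ e + 484) (+-mono-≤ (^-monoˡ-≤ e 2≤p) (m≤n+m 110 406)) ⟩
  p ^ e + 484 + (p ^ e + 516)      ≡⟨ regroup (p ^ e) 484 516 ⟩
  2 * p ^ e + 2 * 500              ≡⟨ *-distribˡ-+ 2 (p ^ e) 500 ⟨
  2 * (p ^ e + 500)                ∎)
  where
  open ≤-Reasoning
  instance _ = >-nonZero (<-trans z<s 2≤p)
  regroup : ∀ x a b → x + a + (x + b) ≡ 2 * x + (a + b)
  regroup x a b = solve (x ∷ a ∷ b ∷ [])
  22p≤ : 22 * p ≤ p ^ e + 484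
  22p≤ with ≤-total p 22
  ... | inj₁ p≤22 = ≤-trans (*-monoʳ-≤ 22 p≤22) (m≤n+m 484 (p ^ e))
  ... | inj₂ 22≤p = begin
    22 * p       ≤⟨ *-monoˡ-≤ p 22≤p ⟩
    p * p        ≡⟨ cong (p *_) (*-identityʳ p) ⟨
    p ^ 2        ≤⟨ ^-monoʳ-≤ p 2≤e ⟩
    p ^ e        ≤⟨ m≤m+n (p ^ e) 484 ⟩
    p ^ e + 484  ∎

-- The bound 10 on the cofactor is the bound on the ratio between a number and its reverse.
SmallTimesPrime : ℕ → Set
SmallTimesPrime n = ∃[ k ] ∃[ p ] k ≤ 10 × Prime p × Coprime k p × n ≡ k * p

ω-small : ∀ {n x} → ω n ≤ x → x ≤ 90 → 11 * ω n ≤ n + 1000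
ω-small {n} ωn≤x x≤90 =
  ≤-trans (*-monoʳ-≤ 11 (≤-trans ωn≤x x≤90)) (≤-trans (m≤n+m 990 10) (m≤n+m 1000 n))

-- If both coprime factors exceed 10, their sum is at most about an eleventh of their product. If
-- one is at most 10, either the other is controlled by induction or the product is again a small
-- multiple of a prime. The constant 1000 absorbs all small cases.
smallTimesPrime⊎11*ω≤ : ∀ n .{{_ : NonZero n}} → SmallTimesPrime n ⊎ 11 * ω n ≤ n + 1000
smallTimesPrime⊎11*ω≤ = coprimeInduction Q (inj₂ z≤n) step
  where
  open ≤-Reasoning
  Q = λ n → SmallTimesPrime n ⊎ 11 * ω n ≤ n + 1000
  step : ∀ {p} → Prime p → ∀ e m .{{_ : NonZero m}} → Coprime (p ^ suc e) m → Q m → Q (p ^ suc e * m)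
  step {p} pr e m a⊥m Qm = by-size (m ≤? 10) (a ≤? 10) e refl Qm
    where
    a = p ^ suc e
    instance
      a≢0 : NonZero a
      a≢0 = m^n≢0 p (suc e) {{prime⇒nonZero pr}}
    2≤p = nonTrivial⇒n>1 p {{prime⇒nonTrivial pr}}
    ω[am] : ω (a * m) ≡ ω a + ω m
    ω[am] = ω-* a m a⊥m
    by-size : Dec (m ≤ 10) → Dec (a ≤ 10) → ∀ d → e ≡ d → Q m → Q (a * m)
    by-size (yes m≤10) _ zero refl _ =
      inj₁ (m , p , m≤10 , pr , Coprime.sym (subst (λ x → Coprime x m) (*-identityʳ p) a⊥m)
           , trans (*-comm a m) (cong (m *_) (*-identityʳ p)))
    -- A proper prime power loses at most 500, and `11 * ω m ≤ 110` fits into the other 500.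
    by-size (yes m≤10) _ (suc d) refl _ = inj₂ (begin
      11 * ω (a * m)             ≡⟨ cong (11 *_) (trans ω[am] (cong (_+ ω m) (ω-primePower pr d))) ⟩
      11 * (p + 2+ d + ω m)      ≡⟨ *-distribˡ-+ 11 (p + 2+ d) (ω m) ⟩
      11 * (p + 2+ d) + 11 * ω m
        ≤⟨ +-mono-≤ (11*[p+e]≤p^e+500 p (2+ d) 2≤p (s≤s (s≤s z≤n)))
             (≤-trans (*-monoʳ-≤ 11 (≤-trans (ω-≤ m) m≤10)) (m≤n+m 110 390)) ⟩
      (a + 500) + 500            ≡⟨ +-assoc a 500 500 ⟩
      a + 1000                   ≤⟨ +-monoˡ-≤ 1000 (m≤m*n a m) ⟩
      a * m + 1000               ∎)
    by-size (no m≰10) (no a≰10) _ _ _ = inj₂ (begin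
      11 * ω (a * m)    ≡⟨ cong (11 *_) ω[am] ⟩
      11 * (ω a + ω m) ≤⟨ *-monoʳ-≤ 11 (+-mono-≤ (ω-≤ a) (ω-≤ m)) ⟩
      11 * (a + m)      ≤⟨ 11*[m+n]≤m*n+1000 (≰⇒> a≰10) (≰⇒> m≰10) ⟩
      a * m + 1000      ∎)
    -- Absorbing `11 * a + m` into `a * m` requires `m ≥ 22`; below that, `ω (a * m)` itself is at
    -- most 32.
    by-size (no m≰10) (yes a≤10) _ _ (inj₂ bound) with m ≤? 22
    ... | yes m≤22 = inj₂ (ω-small {a * m} (begin
      ω (a * m)    ≡⟨ ω[am] ⟩
      ω a + ω m    ≤⟨ +-mono-≤ (≤-trans (ω-≤ a) a≤10) (≤-trans (ω-≤ m) m≤22) ⟩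
      32           ∎) (m≤n+m 32 58))
    ... | no  m≰22 = inj₂ (begin
      11 * ω (a * m)         ≡⟨ trans (cong (11 *_) ω[am]) (*-distribˡ-+ 11 (ω a) (ω m)) ⟩
      11 * ω a + 11 * ω m    ≤⟨ +-mono-≤ (*-monoʳ-≤ 11 (ω-≤ a)) bound ⟩
      11 * a + (m + 1000)    ≡⟨ +-assoc (11 * a) m 1000 ⟨
      11 * a + m + 1000      ≤⟨ +-monoˡ-≤ 1000 (c*m+n≤m*n {c = 11} (2≤primePower pr e) (<⇒≤ (≰⇒> m≰22))) ⟩
      a * m + 1000           ∎)
    -- Here `m = k * P`, so the small factor `a` is merged with `k` and the product regrouped as
    -- `(a * k) * P`.
    by-size (no _) (yes a≤10) _ _ (inj₁ (k , P , k≤10 , Ppr , k⊥P , m≡kP)) = by-product (a * k ≤? 10) (P ≤? 10)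
      where
      instance
        k≢0 : NonZero k
        k≢0 = m*n≢0⇒m≢0 k {{subst NonZero m≡kP it}}
        P≢0 : NonZero P
        P≢0 = prime⇒nonZero Ppr
        ak≢0 : NonZero (a * k)
        ak≢0 = m*n≢0 a k
      am≡akP : a * m ≡ a * k * P
      am≡akP = trans (cong (a *_) m≡kP) (sym (*-assoc a k P))
      ak⊥P : Coprime (a * k) P
      ak⊥P = coprime-* (coprime-∣ʳ a⊥m (subst (P ∣_) (sym m≡kP) (n∣m*n k))) k⊥P
      by-product : Dec (a * k ≤ 10) → Dec (P ≤ 10) → Q (a * m)
      by-product (yes ak≤10) _ = inj₁ (a * k , P , ak≤10 , Ppr , ak⊥P , am≡akP)
      by-product (no _) (yes P≤10) = inj₂ (ω-small {a * m} (begin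
        ω (a * m)           ≡⟨ ω[am] ⟩
        ω a + ω m           ≡⟨ cong (λ x → ω a + x) (trans (cong ω m≡kP) (ω-* k P k⊥P)) ⟩
        ω a + (ω k + ω P)   ≤⟨ +-mono-≤ (≤-trans (ω-≤ a) a≤10)
                                 (+-mono-≤ (≤-trans (ω-≤ k) k≤10) (≤-trans (ω-≤ P) P≤10)) ⟩
        30                  ∎) (m≤n+m 30 60))
      by-product (no ak≰10) (no P≰10) = inj₂ (begin
        11 * ω (a * m)            ≡⟨ cong (λ x → 11 * ω x) am≡akP ⟩
        11 * ω (a * k * P)        ≡⟨ cong (11 *_) (ω-* (a * k) P ak⊥P) ⟩
        11 * (ω (a * k) + ω P)    ≤⟨ *-monoʳ-≤ 11 (+-mono-≤ (ω-≤ (a * k)) (ω-≤ P)) ⟩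
        11 * (a * k + P)          ≤⟨ 11*[m+n]≤m*n+1000 (≰⇒> ak≰10) (≰⇒> P≰10) ⟩
        a * k * P + 1000          ≡⟨ cong (_+ 1000) am≡akP ⟨
        a * m + 1000              ∎)

-- Digit strings with their outer digits split off

fromDigits-∷ʳ : ∀ ds (a : Digit 10) → fromDigits (ds ∷ʳ a) ≡ fromDigits ds + toℕ a * 10 ^ length ds
fromDigits-∷ʳ []       a = trans (+-identityʳ (toℕ a)) (sym (*-identityʳ (toℕ a)))
fromDigits-∷ʳ (c ∷ ds) a =
  trans (cong (λ x → toℕ c + x * 10) (fromDigits-∷ʳ ds a)) (shift (toℕ c) (fromDigits ds) (toℕ a) (10 ^ length ds) 10)
  where
  shift : ∀ c y a e b → c + (y + a * e) * b ≡ c + y * b + a * (b * e)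
  shift c y a e b = solve (c ∷ y ∷ a ∷ e ∷ b ∷ [])

digit+*10< : ∀ {d m n} → d < 10 → m < n → d + m * 10 < n * 10
digit+*10< {d} {m} d<10 m<n = ≤-trans (+-monoˡ-≤ (m * 10) d<10) (*-monoˡ-≤ 10 m<n)

fromDigits<10^length : ∀ (ds : Expansion 10) → fromDigits ds < 10 ^ length ds
fromDigits<10^length []       = z<s
fromDigits<10^length (d ∷ ds) =
  subst (fromDigits (d ∷ ds) <_) (*-comm (10 ^ length ds) 10) (digit+*10< (toℕ<n d) (fromDigits<10^length ds))

-- The least significant digit comes first, so `c` is the last decimal digit and `a` the leading
-- one.
framed : Digit 10 → Expansion 10 → Digit 10 → Expansion 10
framed c ds a = c ∷ (ds ∷ʳ a)

fromDigits-framed : ∀ c ds a →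
  fromDigits (framed c ds a) ≡ toℕ c + (fromDigits ds + toℕ a * 10 ^ length ds) * 10
fromDigits-framed c ds a = cong (λ x → toℕ c + x * 10) (fromDigits-∷ʳ ds a)

reverse-framed : ∀ c ds a → reverse (framed c ds a) ≡ framed a (reverse ds) c
reverse-framed c ds a = trans (unfold-reverse c (ds ∷ʳ a)) (cong (_∷ʳ c) (reverse-++ ds (a ∷ [])))

fromDigits-reverse-framed : ∀ c ds a →
  fromDigits (reverse (framed c ds a)) ≡ toℕ a + (fromDigits (reverse ds) + toℕ c * 10 ^ length ds) * 10
fromDigits-reverse-framed c ds a = trans (cong fromDigits (reverse-framed c ds a))
  (trans (fromDigits-framed a (reverse ds) c)
         (cong (λ l → toℕ a + (fromDigits (reverse ds) + toℕ c * 10 ^ l) * 10) (length-reverse ds)))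

fromDigits-reverse< : ∀ (ds : Expansion 10) → fromDigits (reverse ds) < 10 ^ length ds
fromDigits-reverse< ds =
  subst (λ l → fromDigits (reverse ds) < 10 ^ l) (length-reverse ds) (fromDigits<10^length (reverse ds))

-- Dropping zeros from the most significant end brings an expansion into the shape that
-- `r-fromDigits` asks for.
leadingDigit : ∀ (ds : Expansion 10) → fromDigits ds ≢ 0 →
               ∃[ es ] ∃[ d ] toℕ d ≢ 0 × fromDigits {10} (es ∷ʳ d) ≡ fromDigits ds
leadingDigit []       0≢0 = contradiction refl 0≢0
leadingDigit (c ∷ ds) n≢0 with fromDigits ds ≟ 0
... | yes eq = [] , c , (λ c≡0 → n≢0 (cong₂ (λ x y → x + y * 10) c≡0 eq)) , cong (λ x → toℕ c + x * 10) (sym eq)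
... | no neq with es , d , d≢0 , eq ← leadingDigit ds neq =
  c ∷ es , d , d≢0 , cong (λ x → toℕ c + x * 10) eq

-- What k n = r(n) + j says about the last digit c and the first digit a of n
-- alone: an upper bound on c, a lower bound on c, and a congruence modulo 10.
EndDigits : (k j c a : ℕ) → Set
EndDigits k j c a =
  c < k * suc a × (k * a ≤ c ⊎ k * a ≤ suc c × k * c + 10 ≤ a + j) × (k * c) % 10 ≡ (a + j) % 10

endDigits? : ∀ k j c a → Dec (EndDigits k j c a)
endDigits? k j c a =
  c <? k * suc a ×-dec (k * a ≤? c ⊎-dec k * a ≤? suc c ×-dec k * c + 10 ≤? a + j)
  ×-dec (k * c) % 10 ≟ (a + j) % 10

-- Here `e` is a power of ten, and `y` and `z` are the values of the inner digits before and after
-- reversal. Of these only `y < e` and `z < e` enter; comparing sizes gives the two bounds, and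
-- reduction modulo 10 the congruence.
endDigits : ∀ k j {c a y z e} .{{_ : NonZero k}} → c < 10 → y < e → z < e → a + j < 10 + e * 10 →
            k * (c + (y + a * e) * 10) ≡ a + (z + c * e) * 10 + j → EndDigits k j c a
endDigits k j {c} {a} {y} {z} {e} c<10 y<e z<e a+j<10+10e eq = upper , lower , mod10
  where
  open ≤-Reasoning
  upper : c < k * suc a
  upper = *-cancelʳ-< (e * 10) c (k * suc a) (begin-strict
    c * (e * 10)                  ≡⟨ *-assoc c e 10 ⟨
    c * e * 10                    ≤⟨ *-monoˡ-≤ 10 (m≤n+m (c * e) z) ⟩
    (z + c * e) * 10              ≤⟨ m≤n+m _ a ⟩
    a + (z + c * e) * 10          ≤⟨ m≤m+n _ j ⟩
    a + (z + c * e) * 10 + j      ≡⟨ eq ⟨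
    k * (c + (y + a * e) * 10)    <⟨ *-monoʳ-< k (digit+*10< c<10 (+-monoˡ-< (a * e) y<e)) ⟩
    k * (suc a * e * 10)          ≡⟨ cong (k *_) (*-assoc (suc a) e 10) ⟩
    k * (suc a * (e * 10))        ≡⟨ *-assoc k (suc a) (e * 10) ⟨
    k * suc a * (e * 10)          ∎)

  mod10 : (k * c) % 10 ≡ (a + j) % 10
  mod10 = begin-equality
    (k * c) % 10                                ≡⟨ [m+kn]%n≡m%n (k * c) (k * (y + a * e)) 10 ⟨
    (k * c + k * (y + a * e) * 10) % 10         ≡⟨ cong (_% 10) (distrib k c (y + a * e) 10) ⟩
    (k * (c + (y + a * e) * 10)) % 10           ≡⟨ cong (_% 10) eq ⟩
    (a + (z + c * e) * 10 + j) % 10             ≡⟨ cong (_% 10) (swapʳ a _ j) ⟩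
    (a + j + (z + c * e) * 10) % 10             ≡⟨ [m+kn]%n≡m%n (a + j) (z + c * e) 10 ⟩
    (a + j) % 10                                ∎
    where
    distrib : ∀ k c x b → k * c + k * x * b ≡ k * (c + x * b)
    distrib k c x b = solve (k ∷ c ∷ x ∷ b ∷ [])
    swapʳ : ∀ a x j → a + x + j ≡ a + j + x
    swapʳ a x j = solve (a ∷ x ∷ j ∷ [])

  lower : k * a ≤ c ⊎ k * a ≤ suc c × k * c + 10 ≤ a + j
  lower with k * a ≤? c
  ... | yes ka≤c = inj₁ ka≤c
  ... | no  ka≰c
    -- With `k * a = c + 1 + t` and `e = z + 1 + s`, cancelling `z * 10` and `c * e * 10` leaves `k
    -- * c + 10 + (s + t * e + k * y) * 10 = a +
    -- j`. A positive `t` would make the left side at least `10 + e * 10`, so `t = 0`.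
    with t , 1+c+t≡ka ← m≤n⇒∃[o]m+o≡n (≰⇒> ka≰c) | s , 1+z+s≡e ← m≤n⇒∃[o]m+o≡n z<e
    = inj₂ (ka≤1+c t s 1+c+t≡ka (excess t s 1+c+t≡ka 1+z+s≡e)
           , m+o≡n⇒m≤n ((s + t * e + k * y) * 10) (excess t s 1+c+t≡ka 1+z+s≡e))
    where
    expandˡ : ∀ k c y a e b → k * (c + (y + a * e) * b) ≡ k * c + k * y * b + k * a * e * b
    expandˡ k c y a e b = solve (k ∷ c ∷ y ∷ a ∷ e ∷ b ∷ [])
    regroup : ∀ kc ky c t e b →
      kc + ky * b + (suc c + t) * e * b ≡ kc + (e + t * e + ky) * b + c * e * b
    regroup kc ky c t e b = solve (kc ∷ ky ∷ c ∷ t ∷ e ∷ b ∷ [])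
    peel : ∀ kc w z s b → kc + (suc z + s + w) * b ≡ kc + b + (s + w) * b + z * b
    peel kc w z s b = solve (kc ∷ w ∷ z ∷ s ∷ b ∷ [])
    expandʳ : ∀ a z x j b → a + (z + x) * b + j ≡ a + j + z * b + x * b
    expandʳ a z x j b = solve (a ∷ z ∷ x ∷ j ∷ b ∷ [])
    excess : ∀ t s → suc c + t ≡ k * a → suc z + s ≡ e → k * c + 10 + (s + t * e + k * y) * 10 ≡ a + j
    excess t s 1+c+t≡ka 1+z+s≡e = +-cancelʳ-≡ (z * 10) _ _ (+-cancelʳ-≡ (c * e * 10) _ _ (begin-equality
      k * c + 10 + (s + t * e + k * y) * 10 + z * 10 + c * e * 10
        ≡⟨ cong (λ x → k * c + 10 + x * 10 + z * 10 + c * e * 10) (+-assoc s (t * e) (k * y)) ⟩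
      k * c + 10 + (s + (t * e + k * y)) * 10 + z * 10 + c * e * 10
        ≡⟨ cong (_+ c * e * 10) (peel (k * c) (t * e + k * y) z s 10) ⟨
      k * c + (suc z + s + (t * e + k * y)) * 10 + c * e * 10
        ≡⟨ cong (λ x → k * c + (x + (t * e + k * y)) * 10 + c * e * 10) 1+z+s≡e ⟩
      k * c + (e + (t * e + k * y)) * 10 + c * e * 10
        ≡⟨ cong (λ x → k * c + x * 10 + c * e * 10) (+-assoc e (t * e) (k * y)) ⟨
      k * c + (e + t * e + k * y) * 10 + c * e * 10
        ≡⟨ regroup (k * c) (k * y) c t e 10 ⟨
      k * c + k * y * 10 + (suc c + t) * e * 10
        ≡⟨ cong (λ x → k * c + k * y * 10 + x * e * 10) 1+c+t≡ka ⟩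
      k * c + k * y * 10 + k * a * e * 10
        ≡⟨ expandˡ k c y a e 10 ⟨
      k * (c + (y + a * e) * 10)
        ≡⟨ eq ⟩
      a + (z + c * e) * 10 + j
        ≡⟨ expandʳ a z (c * e) j 10 ⟩
      a + j + z * 10 + c * e * 10 ∎))
    ka≤1+c : ∀ t s → suc c + t ≡ k * a → k * c + 10 + (s + t * e + k * y) * 10 ≡ a + j → k * a ≤ suc c
    ka≤1+c zero    _  1+c≡ka _ = ≤-reflexive (trans (sym 1+c≡ka) (+-identityʳ (suc c)))
    ka≤1+c (suc t) s _     ex = contradiction a+j<10+10e (≤⇒≯ (begin
      10 + e * 10    ≤⟨ +-mono-≤ (m≤n+m 10 (k * c)) (*-monoˡ-≤ 10
                          (≤-trans (m≤m+n e (t * e)) (≤-trans (m≤n+m (suc t * e) s) (m≤m+n _ (k * y))))) ⟩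
      k * c + 10 + (s + suc t * e + k * y) * 10  ≡⟨ ex ⟩
      a + j          ∎))

abstract
  -- This and the next two are decided over all 100 pairs of digits. The shift `j` is 0 for plain
  -- doubling and `k * v(k)` for a palindrome, hence 4 for `k = 2` and 16 for `k = 4`.
  endDigits-2,0 : ∀ (c a : Digit 10) → EndDigits 2 0 (toℕ c) (toℕ a) → toℕ c ≡ 0 × toℕ a ≡ 0
  endDigits-2,0 = toWitness {a? = Fin.all? λ c → Fin.all? λ a →
    endDigits? 2 0 (toℕ c) (toℕ a) →-dec (toℕ c ≟ 0 ×-dec toℕ a ≟ 0)} _

  endDigits-2,4 : ∀ (c a : Digit 10) → EndDigits 2 4 (toℕ c) (toℕ a) → 2 ∤ toℕ c → toℕ a ≢ 0 →
                  toℕ c ≡ 9 × toℕ a ≡ 4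
  endDigits-2,4 = toWitness {a? = Fin.all? λ c → Fin.all? λ a →
    endDigits? 2 4 (toℕ c) (toℕ a) →-dec ¬? (2 ∣? toℕ c) →-dec ¬? (toℕ a ≟ 0) →-dec (toℕ c ≟ 9 ×-dec toℕ a ≟ 4)} _

  endDigits-4,16 : ∀ (c a : Digit 10) → EndDigits 4 16 (toℕ c) (toℕ a) → 2 ∤ toℕ c → ¬ toℕ a ≢ 0
  endDigits-4,16 = toWitness {a? = Fin.all? λ c → Fin.all? λ a →
    endDigits? 4 16 (toℕ c) (toℕ a) →-dec ¬? (2 ∣? toℕ c) →-dec ¬? (¬? (toℕ a ≟ 0))} _

-- Strings whose value is doubled by reversal

2*n≡n⇒n≡0 : ∀ {n} → 2 * n ≡ n → n ≡ 0
2*n≡n⇒n≡0 {n} eq = m+n≡0⇒m≡0 n (+-cancelˡ-≡ n (n + 0) 0 (trans eq (sym (+-identityʳ n))))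

-- Both outer digits must be 0, and then the inner string satisfies the same equation. As the inner
-- string is not a structural part of the list, the recursion runs on the length bound `n`.
double≡reverse⇒0 : ∀ n (ds : Expansion 10) → length ds ≤ n →
                   2 * fromDigits ds ≡ fromDigits (reverse ds) → fromDigits ds ≡ 0
double≡reverse⇒0 n []       _ _ = refl
double≡reverse⇒0 (suc n) (c ∷ es) (s≤s |es|≤n) eq with initLast es
-- A single digit is its own reverse.
... | []       = 2*n≡n⇒n≡0 eq
... | ds ∷ʳ′ a = let c≡0 , a≡0 = endDigits-2,0 c a ends in begin
  fromDigits (framed c ds a)         ≡⟨ fromDigits-framed c ds a ⟩
  toℕ c + (y + toℕ a * e) * 10       ≡⟨ cong₂ (λ c a → c + (y + a * e) * 10) c≡0 a≡0 ⟩
  (y + 0) * 10                       ≡⟨ cong (_* 10) (+-identityʳ y) ⟩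
  y * 10                             ≡⟨ cong (_* 10) (double≡reverse⇒0 n ds |ds|≤n (inner c≡0 a≡0)) ⟩
  0                                  ∎
  where
  open ≡-Reasoning
  y = fromDigits ds
  z = fromDigits (reverse ds)
  e = 10 ^ length ds
  eq′ : 2 * (toℕ c + (y + toℕ a * e) * 10) ≡ toℕ a + (z + toℕ c * e) * 10
  eq′ = trans (cong (2 *_) (sym (fromDigits-framed c ds a))) (trans eq (fromDigits-reverse-framed c ds a))
  ends : EndDigits 2 0 (toℕ c) (toℕ a)
  ends = endDigits 2 0 {e = e} (toℕ<n c) (fromDigits<10^length ds) (fromDigits-reverse< ds)
    (subst (_< 10 + e * 10) (sym (+-identityʳ _)) (≤-trans (toℕ<n a) (m≤m+n 10 (e * 10))))
    (trans eq′ (sym (+-identityʳ _)))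
  inner : toℕ c ≡ 0 → toℕ a ≡ 0 → 2 * y ≡ z
  inner c≡0 a≡0 = *-cancelʳ-≡ (2 * y) z 10 (begin
    2 * y * 10                            ≡⟨ *-assoc 2 y 10 ⟩
    2 * (y * 10)                          ≡⟨ cong (λ x → 2 * (x * 10)) (+-identityʳ y) ⟨
    2 * (0 + (y + 0 * e) * 10)            ≡⟨ cong₂ (λ c a → 2 * (c + (y + a * e) * 10)) c≡0 a≡0 ⟨
    2 * (toℕ c + (y + toℕ a * e) * 10)    ≡⟨ eq′ ⟩
    toℕ a + (z + toℕ c * e) * 10          ≡⟨ cong₂ (λ c a → a + (z + c * e) * 10) c≡0 a≡0 ⟩
    (z + 0) * 10                          ≡⟨ cong (_* 10) (+-identityʳ z) ⟩
    z * 10                                ∎)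
  |ds|≤n : length ds ≤ n
  |ds|≤n = ≤-trans (m≤m+n (length ds) 1) (subst (_≤ n) (length-++ ds) |es|≤n)

-- On `Digit 10`, `opposite` sends `d` to `9 - d`, so the two strings add without carries to a
-- string of nines.
fromDigits-complement : ∀ (ds : Expansion 10) →
  fromDigits (map opposite ds) + suc (fromDigits ds) ≡ 10 ^ length ds
fromDigits-complement []       = refl
fromDigits-complement (d ∷ ds) = begin
  toℕ (opposite d) + u * 10 + suc (toℕ d + w * 10)   ≡⟨ regroup (toℕ (opposite d)) (toℕ d) u w 10 ⟩
  toℕ (opposite d) + suc (toℕ d) + (u + w) * 10      ≡⟨ cong (_+ (u + w) * 10) opposite+suc ⟩
  suc (u + w) * 10                                   ≡⟨ cong (_* 10) (+-suc u w) ⟨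
  (u + suc w) * 10                                   ≡⟨ cong (_* 10) (fromDigits-complement ds) ⟩
  10 ^ length ds * 10                                ≡⟨ *-comm (10 ^ length ds) 10 ⟩
  10 ^ length (d ∷ ds)                               ∎
  where
  open ≡-Reasoning
  u = fromDigits (map opposite ds)
  w = fromDigits ds
  opposite+suc : toℕ (opposite d) + suc (toℕ d) ≡ 10
  opposite+suc = trans (cong (_+ suc (toℕ d)) (opposite-prop d)) (m∸n+n≡m (toℕ<n d))
  regroup : ∀ o d u w b → o + u * b + suc (d + w * b) ≡ o + suc d + (u + w) * b
  regroup o d u w b = solve (o ∷ d ∷ u ∷ w ∷ b ∷ [])

-- In terms of the complement y of the digits to 9, the hypothesis says that
-- reversing y doubles it.
reverse+10^length≡1+double⇒nines : ∀ (ds : Expansion 10) →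
  fromDigits (reverse ds) + 10 ^ length ds ≡ suc (2 * fromDigits ds) → suc (fromDigits ds) ≡ 10 ^ length ds
reverse+10^length≡1+double⇒nines ds eq = begin
  suc w        ≡⟨ cong (_+ suc w) (double≡reverse⇒0 (length cs) cs ≤-refl 2y≡z) ⟨
  y + suc w    ≡⟨ y+1+w≡e ⟩
  e            ∎
  where
  open ≡-Reasoning
  cs = map opposite ds
  w  = fromDigits ds
  w′ = fromDigits (reverse ds)
  y  = fromDigits cs
  z  = fromDigits (reverse cs)
  e  = 10 ^ length ds
  y+1+w≡e : y + suc w ≡ e
  y+1+w≡e = fromDigits-complement ds
  z+1+w′≡e : z + suc w′ ≡ e
  z+1+w′≡e = begin
    z + suc w′                                          ≡⟨ cong (λ xs → fromDigits xs + suc w′) (reverse-map opposite ds) ⟨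
    fromDigits (map opposite (reverse ds)) + suc w′     ≡⟨ fromDigits-complement (reverse ds) ⟩
    10 ^ length (reverse ds)                            ≡⟨ cong (10 ^_) (length-reverse ds) ⟩
    e                                                   ∎
  regroupˡ : ∀ y w → 2 * y + (suc w + suc w) ≡ y + suc w + (y + suc w)
  regroupˡ y w = solve (y ∷ w ∷ [])
  regroupʳ : ∀ z w → z + suc (suc (2 * w)) ≡ z + (suc w + suc w)
  regroupʳ z w = solve (z ∷ w ∷ [])
  assocʳ : ∀ z w e → z + suc w + e ≡ z + suc (w + e)
  assocʳ z w e = solve (z ∷ w ∷ e ∷ [])
  -- Adding `2 * suc w` makes the left side `2 * e`. One `e` is rewritten as `z + suc w′`, and `eq`
  -- replaces `w′ + e` by `suc (2 * w)`.
  2y≡z : 2 * y ≡ z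
  2y≡z = +-cancelʳ-≡ (suc w + suc w) _ _ (begin
    2 * y + (suc w + suc w)      ≡⟨ regroupˡ y w ⟩
    y + suc w + (y + suc w)      ≡⟨ cong₂ _+_ (trans y+1+w≡e (sym z+1+w′≡e)) y+1+w≡e ⟩
    z + suc w′ + e               ≡⟨ assocʳ z w′ e ⟩
    z + suc (w′ + e)             ≡⟨ cong (λ x → z + suc x) eq ⟩
    z + suc (suc (2 * w))        ≡⟨ regroupʳ z w ⟩
    z + (suc w + suc w)          ∎)

-- Primes below 1000

-- The fuel bounds the number of steps, and 45 steps suffice below 1000; no
-- correctness proof is needed as the result is checked wherever it is used.
trialDivision : (fuel d n : ℕ) → List ℕ
trialDivision zero       d         n = n ∷ []
trialDivision (suc fuel) zero      n = n ∷ []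
trialDivision (suc fuel) d@(suc _) n with n <? d * d
... | yes _ = n ∷ []
... | no  _ with n % d ≟ 0
...   | yes _ = d ∷ trialDivision fuel d (n / d)
...   | no  _ = trialDivision fuel (suc d) n

-- For a prime `n` and `q = r n` this refutes that `n` is a palindrome. The explicit factorisation
-- lets `v(q)` be computed without evaluating `factorise`.
ReverseCertificate : ℕ → ℕ → Set
ReverseCertificate n q = q ≡ n ⊎ (q ≡ product ps × All Prime ps × vFactors ps ≢ n)
  where ps = trialDivision 45 2 q

reverseCertificate? : ∀ n q → Dec (ReverseCertificate n q)
reverseCertificate? n q = q ≟ n ⊎-dec (q ≟ product ps ×-dec All.all? prime? ps ×-dec ¬? (vFactors ps ≟ n))
  where ps = trialDivision 45 2 q

abstract
  smallPrimes : ∀ {p} → p < 1000 → Prime p → ReverseCertificate p (r p)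
  smallPrimes = toWitness {a? = allUpTo? (λ p → prime? p →-dec reverseCertificate? p (r p)) 1000} _

vPalindrome-≥1000 : ∀ {p} → Prime p → VPalindrome p → 1000 ≤ p
vPalindrome-≥1000 {p} pr pal with 1000 ≤? p
... | yes 1000≤p = 1000≤p
... | no 1000≰p with smallPrimes (≰⇒> 1000≰p) pr
...   | inj₁ rp≡p = contradiction (sym rp≡p) (VPalindrome.n≢rn pal)
...   | inj₂ (rp≡∏ , prs , v≢p) = contradiction (ℤ.+-injective (begin
  + vFactors (trialDivision 45 2 (r p))
    ≡⟨ v-factors (r p) {{subst NonZero (sym rp≡∏) (productOfPrimes≢0 prs)}}
         (record { isFactorisation = rp≡∏ ; factorsPrime = prs }) ⟨
  v (r p)  ≡⟨ VPalindrome.vn≡vrn pal ⟨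
  v p      ≡⟨ v-prime pr ⟩
  + p      ∎)) v≢p
  where open ≡-Reasoning

-- From a palindromic prime to the form 49...9

prime∧≢2⇒2∤ : ∀ {p} → Prime p → p ≢ 2 → 2 ∤ p
prime∧≢2⇒2∤ pr p≢2 2∣p with prime⇒irreducible pr 2∣p
... | inj₂ 2≡p = p≢2 (sym 2≡p)

2∤n⇒n%2≡1 : ∀ {n} → 2 ∤ n → n % 2 ≡ 1
2∤n⇒n%2≡1 {n} 2∤n with n % 2 in eq | m%n<n n 2
... | 0    | _ = contradiction (m%n≡0⇒n∣m n 2 eq) 2∤n
... | 1    | _ = refl
... | 2+ _ | s≤s (s≤s ())

odd+odd : ∀ {m n} → 2 ∤ m → 2 ∤ n → 2 ∣ m + n
odd+odd {m} {n} 2∤m 2∤n = m%n≡0⇒n∣m (m + n) 2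
  (trans (%-distribˡ-+ m n 2) (cong₂ (λ x y → (x + y) % 2) (2∤n⇒n%2≡1 2∤m) (2∤n⇒n%2≡1 2∤n)))

NinesForm : ℕ → Set
NinesForm p = ∃[ m ] (4 ≤ m × p ≡ 5 * 10 ^ m ∸ 1 × Prime (5 * 10 ^ m ∸ 3))

-- c is the last and a the first digit of p.
record Frame (p : ℕ) : Set where
  field
    c a    : Digit 10
    ds     : Expansion 10
    a≢0    : toℕ a ≢ 0
    p-form : p ≡ toℕ c + (fromDigits ds + toℕ a * 10 ^ length ds) * 10
    r-form : r p ≡ toℕ a + (fromDigits (reverse ds) + toℕ c * 10 ^ length ds) * 10

frame : ∀ p → 10 ≤ p → Frame p
frame p 10≤p with leadingDigit (digits p) (λ eq → m<n⇒n≢0 10≤p (trans (sym (fromDigits-digits p)) eq))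
... | []     , a , a≢0 , eq = contradiction (toℕ<n a) (≤⇒≯ (subst (10 ≤_)
  (sym (trans (sym (+-identityʳ (toℕ a))) (trans eq (fromDigits-digits p)))) 10≤p))
... | c ∷ ds , a , a≢0 , eq = record
  { c = c ; a = a ; ds = ds ; a≢0 = a≢0
  ; p-form = trans (sym p≡) (fromDigits-framed c ds a)
  ; r-form = trans (cong r (sym p≡)) (trans (r-fromDigits (c ∷ ds) a a≢0) (fromDigits-reverse-framed c ds a))
  }
  where p≡ = trans eq (fromDigits-digits p)

module LargePalindrome {p} (pr : Prime p) (pal : VPalindrome p) where
  open VPalindrome pal
  open Frame (frame p (≤-trans (m≤n+m 10 990) (vPalindrome-≥1000 pr pal)))
  open ≤-Reasoning

  q = r p
  y = fromDigits ds
  z = fromDigits (reverse ds)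
  e = 10 ^ length ds

  y<e = fromDigits<10^length ds
  z<e = fromDigits-reverse< ds

  1000≤p : 1000 ≤ p
  1000≤p = vPalindrome-≥1000 pr pal

  small-elim : ∀ {A : Set} → p < 1000 → A
  small-elim p<1000 = contradiction 1000≤p (<⇒≱ p<1000)

  d+[x+d′e]*10<10*e*10 : ∀ (d d′ : Digit 10) {x} → x < e → toℕ d + (x + toℕ d′ * e) * 10 < 10 * e * 10
  d+[x+d′e]*10<10*e*10 d d′ {x} x<e =
    digit+*10< (toℕ<n d) (≤-trans (+-monoˡ-≤ (toℕ d′ * e) x<e) (*-monoˡ-≤ e (toℕ<n d′)))

  -- The leading digit of `p` is nonzero, and `q` is read from equally many digits.
  q<10p : q < 10 * p
  q<10p = begin-strict
    q                                      ≡⟨ r-form ⟩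
    toℕ a + (z + toℕ c * e) * 10           <⟨ d+[x+d′e]*10<10*e*10 a c z<e ⟩
    10 * e * 10                            ≡⟨ *-assoc 10 e 10 ⟩
    10 * (e * 10)                          ≤⟨ *-monoʳ-≤ 10 (*-monoˡ-≤ 10 e≤ae) ⟩
    10 * (toℕ a * e * 10)                  ≤⟨ *-monoʳ-≤ 10 (*-monoˡ-≤ 10 (m≤n+m (toℕ a * e) y)) ⟩
    10 * ((y + toℕ a * e) * 10)            ≤⟨ *-monoʳ-≤ 10 (m≤n+m _ (toℕ c)) ⟩
    10 * (toℕ c + (y + toℕ a * e) * 10)    ≡⟨ cong (10 *_) p-form ⟨
    10 * p                                 ∎
    where
    e≤ae : e ≤ toℕ a * e
    e≤ae = m≤n*m e (toℕ a) {{≢-nonZero a≢0}}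

  -- Four or more digits leave at least two inner ones; this makes `e` large enough for the
  -- hypothesis on `a + j` in `endDigits`.
  10<e : 10 < e
  10<e = *-cancelˡ-< 10 10 e (*-cancelʳ-< 10 (10 * 10) (10 * e) (begin-strict
    10 * 10 * 10                       ≤⟨ 1000≤p ⟩
    p                                  ≡⟨ p-form ⟩
    toℕ c + (y + toℕ a * e) * 10       <⟨ d+[x+d′e]*10<10*e*10 c a y<e ⟩
    10 * e * 10                        ∎))

  2∤p : 2 ∤ p
  2∤p = prime∧≢2⇒2∤ pr λ p≡2 → small-elim (subst (_< 1000) (sym p≡2) (m≤m+n 3 997))

  2∤c : 2 ∤ toℕ c
  2∤c 2∣c = 2∤p (subst (2 ∣_) (sym p-form) (∣m∣n⇒∣m+n 2∣c (∣n⇒∣m*n (y + toℕ a * e) (divides 5 refl))))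

  ωq≡p : ω q ≡ p
  ωq≡p = trans (cong ∣_∣ (sym vn≡vrn)) (ω-prime pr)

  q≢0 : q ≢ 0
  -- The default value of `v` at 0 would give `p = 0`.
  q≢0 q≡0 = small-elim (subst (_< 1000) (trans (cong ω (sym q≡0)) ωq≡p) z<s)

  instance
    q-nonZero : NonZero q
    q-nonZero = ≢-nonZero q≢0

  -- Otherwise `11 * p ≤ q + 1000 < 10 * p + 1000`, which contradicts `p ≥ 1000`.
  q-smallTimesPrime : SmallTimesPrime q
  q-smallTimesPrime with smallTimesPrime⊎11*ω≤ q
  ... | inj₁ st = st
  ... | inj₂ 11ω≤ = contradiction 1000≤p (<⇒≱ (+-cancelʳ-< (10 * p) p 1000 (begin-strict
    11 * p          ≡⟨ cong (11 *_) ωq≡p ⟨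
    11 * ω q        ≤⟨ 11ω≤ ⟩
    q + 1000        <⟨ +-monoˡ-< 1000 q<10p ⟩
    10 * p + 1000   ≡⟨ +-comm (10 * p) 1000 ⟩
    1000 + 10 * p   ∎)))

  module _ {P} (Ppr : Prime P) where

    -- As `p` and `s` are odd, `P` would be even, so `P = 2` and `p` is at most 11.
    odd-shift-elim : ∀ {A : Set} s → 2 ∤ s → s < 10 → p ≡ s + P → A
    odd-shift-elim s 2∤s s<10 p≡s+P with P ≟ 2
    ... | yes refl = small-elim (subst (_< 1000) (sym p≡s+P) (≤-trans (+-monoˡ-≤ 2 s<10) (m≤m+n 12 988)))
    ... | no P≢2 = contradiction (subst (2 ∣_) (sym p≡s+P) (odd+odd 2∤s (prime∧≢2⇒2∤ Ppr P≢2))) 2∤p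

    -- This is `k * p = k * P + k * s = q + k * s` in digits, the input of `endDigits` with
    -- `j = k * s`.
    frame-equation : ∀ k s → q ≡ k * P → p ≡ s + P →
      k * (toℕ c + (y + toℕ a * e) * 10) ≡ toℕ a + (z + toℕ c * e) * 10 + k * s
    frame-equation k s q≡kP p≡s+P = begin-equality
      k * (toℕ c + (y + toℕ a * e) * 10)           ≡⟨ cong (k *_) (trans (sym p-form) p≡s+P) ⟩
      k * (s + P)                                  ≡⟨ *-distribˡ-+ k s P ⟩
      k * s + k * P                                ≡⟨ +-comm (k * s) (k * P) ⟩
      k * P + k * s                                ≡⟨ cong (_+ k * s) (trans (sym q≡kP) r-form) ⟩
      toℕ a + (z + toℕ c * e) * 10 + k * s         ∎

    endDigits-p : ∀ k s .{{_ : NonZero k}} → q ≡ k * P → p ≡ s + P → k * s ≤ 16 →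
                  EndDigits k (k * s) (toℕ c) (toℕ a)
    endDigits-p k s q≡kP p≡s+P ks≤16 =
      endDigits k (k * s) (toℕ<n c) y<e z<e
        (≤-trans (+-mono-≤ (toℕ<n a) ks≤16)
          (≤-trans (m≤m+n 26 94) (+-monoʳ-≤ 10 (*-monoˡ-≤ 10 10<e))))
        (frame-equation k s q≡kP p≡s+P)

    1+p≡5*10^m : q ≡ 2 * P → p ≡ 2 + P → suc p ≡ 5 * 10 ^ suc (length ds)
    1+p≡5*10^m q≡2P p≡2+P = begin-equality
      suc p                                ≡⟨ cong suc p-form ⟩
      suc (toℕ c + (y + toℕ a * e) * 10)   ≡⟨ cong₂ (λ c a → suc (c + (y + a * e) * 10)) c≡9 a≡4 ⟩
      (suc y + 4 * e) * 10                 ≡⟨ cong (λ x → (x + 4 * e) * 10) (reverse+10^length≡1+double⇒nines ds z+e≡1+2y) ⟩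
      5 * e * 10                           ≡⟨ *-assoc 5 e 10 ⟩
      5 * (e * 10)                         ≡⟨ cong (5 *_) (*-comm e 10) ⟩
      5 * (10 * e)                         ∎
      where
      c≡9×a≡4 : toℕ c ≡ 9 × toℕ a ≡ 4
      c≡9×a≡4 = endDigits-2,4 c a (endDigits-p 2 2 q≡2P p≡2+P (m≤m+n 4 12)) 2∤c a≢0
      c≡9 = proj₁ c≡9×a≡4
      a≡4 = proj₂ c≡9×a≡4
      expandˡ : ∀ k c y x b → k * (c + (y + x) * b) ≡ k * c + k * y * b + k * x * b
      expandˡ k c y x b = solve (k ∷ c ∷ y ∷ x ∷ b ∷ [])
      regroupˡ : ∀ u v x w → u + v + x + w ≡ u + x + (v + w)
      regroupˡ u v x w = solve (u ∷ v ∷ x ∷ w ∷ [])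
      regroupʳ : ∀ z e w b u v → (z + e) * b + (u + v + w * b) ≡ u + (z + (e + w)) * b + v
      regroupʳ z e w b u v = solve (z ∷ e ∷ w ∷ b ∷ u ∷ v ∷ [])
      z+e≡1+2y : z + e ≡ suc (2 * y)
      -- With `c = 9` and `a = 4` the equation reads `18 + 20y + 80e = 8 + 10z + 90e`; removing
      -- `8 + 80e` and dividing by 10 gives the claim.
      z+e≡1+2y = *-cancelʳ-≡ (z + e) (suc (2 * y)) 10 (+-cancelʳ-≡ (8 + 8 * e * 10) _ _ (begin-equality
        (z + e) * 10 + (8 + 8 * e * 10)               ≡⟨ regroupʳ z e (8 * e) 10 4 4 ⟩
        4 + (z + 9 * e) * 10 + 4                      ≡⟨ cong₂ (λ c a → a + (z + c * e) * 10 + 4) c≡9 a≡4 ⟨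
        toℕ a + (z + toℕ c * e) * 10 + 4              ≡⟨ frame-equation 2 2 q≡2P p≡2+P ⟨
        2 * (toℕ c + (y + toℕ a * e) * 10)            ≡⟨ cong₂ (λ c a → 2 * (c + (y + a * e) * 10)) c≡9 a≡4 ⟩
        2 * (9 + (y + 4 * e) * 10)                    ≡⟨ expandˡ 2 9 y (4 * e) 10 ⟩
        10 + 8 + 2 * y * 10 + 2 * (4 * e) * 10        ≡⟨ cong (λ x → 10 + 8 + 2 * y * 10 + x * 10) (*-assoc 2 4 e) ⟨
        10 + 8 + 2 * y * 10 + 8 * e * 10              ≡⟨ regroupˡ 10 8 (2 * y * 10) (8 * e * 10) ⟩
        suc (2 * y) * 10 + (8 + 8 * e * 10)           ∎))

    ninesForm : ∀ m → p ≡ 2 + P → suc p ≡ 5 * 10 ^ m → NinesForm p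
    ninesForm 0 _ eq = small-elim (subst (_< 1000) (sym (suc-injective eq)) (m≤m+n 5 995))
    ninesForm 1 _ eq = small-elim (subst (_< 1000) (sym (suc-injective eq)) (m≤m+n 50 950))
    ninesForm 2 _ eq = small-elim (subst (_< 1000) (sym (suc-injective eq)) (m≤m+n 500 500))
    -- For `m = 3` the number `P` would be `4997 = 19 * 263`; for smaller `m`, `p` would be below
    -- 1000.
    ninesForm 3 p≡2+P eq
      with prime⇒irreducible (subst Prime (cong (_∸ 3) (trans (cong suc (sym p≡2+P)) eq)) Ppr) {19} (divides 263 refl)
    ... | inj₁ ()
    ... | inj₂ ()
    ninesForm m@(suc (suc (suc (suc _)))) p≡2+P eq =
      m , s≤s (s≤s (s≤s (s≤s z≤n))) , cong (_∸ 1) eq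
      , subst Prime (cong (_∸ 3) (trans (cong suc (sym p≡2+P)) eq)) Ppr

    -- For `k` from 1 to 10, `ω k` evaluates to 0, 2, 3, 4, 5, 5, 7, 5, 5, 7. Parity leaves 1, 2 and
    -- 4; `k = 1` would make `p` equal to its reverse, and `k = 4` fails on the end digits.
    conclude : ∀ k → k ≤ 10 → q ≡ k * P → p ≡ ω k + P → NinesForm p
    conclude 0  _ q≡kP _    = contradiction q≡kP q≢0
    conclude 1  _ q≡kP p≡ = contradiction (trans p≡ (trans (sym (+-identityʳ P)) (sym q≡kP))) n≢rn
    conclude 2  _ q≡kP p≡ = ninesForm (suc (length ds)) p≡ (1+p≡5*10^m q≡kP p≡)
    conclude 3  _ _    p≡ = odd-shift-elim 3 (toWitness {a? = ¬? (2 ∣? 3)} _) (m≤m+n 4 6) p≡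
    conclude 4  _ q≡kP p≡ = contradiction a≢0
      (endDigits-4,16 c a (endDigits-p 4 4 q≡kP p≡ ≤-refl) 2∤c)
    conclude 5  _ _    p≡ = odd-shift-elim 5 (toWitness {a? = ¬? (2 ∣? 5)} _) (m≤m+n 6 4) p≡
    conclude 6  _ _    p≡ = odd-shift-elim 5 (toWitness {a? = ¬? (2 ∣? 5)} _) (m≤m+n 6 4) p≡
    conclude 7  _ _    p≡ = odd-shift-elim 7 (toWitness {a? = ¬? (2 ∣? 7)} _) (m≤m+n 8 2) p≡
    conclude 8  _ _    p≡ = odd-shift-elim 5 (toWitness {a? = ¬? (2 ∣? 5)} _) (m≤m+n 6 4) p≡
    conclude 9  _ _    p≡ = odd-shift-elim 5 (toWitness {a? = ¬? (2 ∣? 5)} _) (m≤m+n 6 4) p≡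
    conclude 10 _ _    p≡ = odd-shift-elim 7 (toWitness {a? = ¬? (2 ∣? 7)} _) (m≤m+n 8 2) p≡
    conclude (suc (suc (suc (suc (suc (suc (suc (suc (suc (suc (suc k)))))))))))  k≤10 _ _ =
      contradiction k≤10 (<⇒≱ (m≤m+n 11 k))

  isNinesForm : NinesForm p
  isNinesForm with k , P , k≤10 , Ppr , k⊥P , q≡kP ← q-smallTimesPrime =
    conclude Ppr k k≤10 q≡kP (begin-equality
      p            ≡⟨ ωq≡p ⟨
      ω q          ≡⟨ cong ω q≡kP ⟩
      ω (k * P)    ≡⟨ ω-* k P {{m*n≢0⇒m≢0 k {{subst NonZero q≡kP q-nonZero}}}} {{prime⇒nonZero Ppr}} k⊥P ⟩
      ω k + ω P    ≡⟨ cong (λ x → ω k + x) (ω-prime Ppr) ⟩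
      ω k + P      ∎)

-- The converse: reversing 49...9

replicate-∷ʳ : ∀ {A : Set} n (x : A) → replicate n x ∷ʳ x ≡ x ∷ replicate n x
replicate-∷ʳ zero    x = refl
replicate-∷ʳ (suc n) x = cong (x ∷_) (replicate-∷ʳ n x)

reverse-replicate : ∀ {A : Set} n (x : A) → reverse (replicate n x) ≡ replicate n x
reverse-replicate zero    x = refl
reverse-replicate (suc n) x =
  trans (unfold-reverse x (replicate n x)) (trans (cong (_∷ʳ x) (reverse-replicate n x)) (replicate-∷ʳ n x))

nines : ℕ → Expansion 10
nines m = replicate m (# 9)

suc-fromDigits-nines : ∀ m → suc (fromDigits (nines m)) ≡ 10 ^ m
suc-fromDigits-nines zero    = refl
suc-fromDigits-nines (suc m) = trans (cong (_* 10) (suc-fromDigits-nines m)) (*-comm (10 ^ m) 10)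

suc-fromDigits-nines-four : ∀ m → suc (fromDigits (nines m ∷ʳ # 4)) ≡ 5 * 10 ^ m
suc-fromDigits-nines-four m = begin
  suc (fromDigits (nines m ∷ʳ # 4))                           ≡⟨ cong suc (fromDigits-∷ʳ (nines m) (# 4)) ⟩
  suc (fromDigits (nines m)) + 4 * 10 ^ length (nines m)      ≡⟨ cong₂ (λ x l → x + 4 * 10 ^ l) (suc-fromDigits-nines m) (length-replicate m) ⟩
  5 * 10 ^ m                                                  ∎
  where open ≡-Reasoning

-- The reverse 9...94 falls short of `10 ^ suc m` by 6; adding 6 avoids truncated subtraction.
r-nines-four : ∀ m → r (fromDigits (nines m ∷ʳ # 4)) + 6 ≡ 2 * (5 * 10 ^ m)
r-nines-four m = begin
  r (fromDigits (nines m ∷ʳ # 4)) + 6             ≡⟨ cong (_+ 6) (r-fromDigits (nines m) (# 4) λ ()) ⟩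
  fromDigits (reverse (nines m ∷ʳ # 4)) + 6       ≡⟨ cong (λ xs → fromDigits xs + 6) (reverse-++ (nines m) (# 4 ∷ [])) ⟩
  4 + fromDigits (reverse (nines m)) * 10 + 6     ≡⟨ cong (λ xs → 4 + fromDigits xs * 10 + 6) (reverse-replicate m (# 9)) ⟩
  4 + fromDigits (nines m) * 10 + 6               ≡⟨ +-comm (4 + fromDigits (nines m) * 10) 6 ⟩
  suc (fromDigits (nines m)) * 10                 ≡⟨ cong (_* 10) (suc-fromDigits-nines m) ⟩
  10 ^ m * 10                                     ≡⟨ *-comm (10 ^ m) 10 ⟩
  10 * 10 ^ m                                     ≡⟨ *-assoc 2 5 (10 ^ m) ⟩
  2 * (5 * 10 ^ m)                                ∎
  where open ≡-Reasoning

-- Here `r p = 2 * P` with `P` an odd prime, so `v (r p) = 2 + P = p`. Since `p` is odd, it differs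
-- from its even reverse and is not divisible by 10.
ninesForm⇒vPalindrome : ∀ {p} → Prime p → NinesForm p → VPalindrome p
ninesForm⇒vPalindrome {p} pr (m , _ , p≡5E∸1 , Ppr) = record
  { positive = >-nonZero⁻¹ p {{prime⇒nonZero pr}}
  ; 10∤n     = λ 10∣p → 2∤p (∣-trans (divides 5 refl) 10∣p)
  ; n≢rn     = λ p≡rp → 2∤p (subst (2 ∣_) (sym (trans p≡rp rp≡2P)) (m∣m*n P))
  ; vn≡vrn   = begin
      v p             ≡⟨ v-prime pr ⟩
      + p             ≡⟨ cong +_ p≡2+P ⟩
      + (2 + P)       ≡⟨ cong₂ ℤ._+_ (v-prime prime[2]) (v-prime Ppr) ⟨
      v 2 ℤ.+ v P     ≡⟨ v-additive 2 P {{_}} {{prime⇒nonZero Ppr}} (prime∤⇒coprime prime[2] 2∤P) ⟨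
      v (2 * P)       ≡⟨ cong v rp≡2P ⟨
      v (r p)         ∎
  }
  where
  open ≡-Reasoning
  P = 5 * 10 ^ m ∸ 3
  3+P≡5E : 3 + P ≡ 5 * 10 ^ m
  -- The truncated subtraction is exact because `3 ≤ 5 ≤ 5 * 10 ^ m`.
  3+P≡5E = m+[n∸m]≡n (≤-trans (m≤m+n 3 2) (*-monoʳ-≤ 5 (m^n>0 10 m)))
  p≡2+P : p ≡ 2 + P
  p≡2+P = trans p≡5E∸1 (cong (_∸ 1) (sym 3+P≡5E))
  p≡nines-four : p ≡ fromDigits (nines m ∷ʳ # 4)
  p≡nines-four = suc-injective (trans (cong suc p≡2+P) (trans 3+P≡5E (sym (suc-fromDigits-nines-four m))))
  rp≡2P : r p ≡ 2 * P
  rp≡2P = +-cancelʳ-≡ 6 (r p) (2 * P) (begin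
    r p + 6             ≡⟨ cong (λ n → r n + 6) p≡nines-four ⟩
    r (fromDigits (nines m ∷ʳ # 4)) + 6 ≡⟨ r-nines-four m ⟩
    2 * (5 * 10 ^ m)    ≡⟨ cong (2 *_) 3+P≡5E ⟨
    2 * (3 + P)         ≡⟨ *-distribˡ-+ 2 3 P ⟩
    6 + 2 * P           ≡⟨ +-comm 6 (2 * P) ⟩
    2 * P + 6           ∎)
  2∤p : 2 ∤ p
  -- If `p` were 2, the prime `P` would be 0.
  2∤p = prime∧≢2⇒2∤ pr λ p≡2 →
    ≢-nonZero⁻¹ P {{prime⇒nonZero Ppr}} (+-cancelˡ-≡ 2 P 0 (trans (sym p≡2+P) p≡2))
  2∤P : 2 ∤ P
  2∤P 2∣P = 2∤p (subst (2 ∣_) (sym p≡2+P) (∣m∣n⇒∣m+n ∣-refl 2∣P))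

theorem1p1 : ∀ (p : ℕ) → Prime p →
    VPalindrome p ⇔ (∃[ m ] (4 ≤ m × p ≡ 5 * 10 ^ m ∸ 1 × Prime (5 * 10 ^ m ∸ 3)))
theorem1p1 p pr = mk⇔ (LargePalindrome.isNinesForm pr) (ninesForm⇒vPalindrome pr)
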